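{- Let $\mathbb K$ be a field of characteristic $p>2$, $n,r\ge1$, $a,\kappa\in\mathbb K^\times$, $\Lambda_1,\dots,\Lambda_n\in\mathbb K$. The scalar $p$-curvature functions $\tilde\Phi_l(s,x)$, $l=1,\dots,r$, and $\tilde\Psi_m(s,x)$, $m=1,\dots,n$, are $a$-periodic in the variables $s=(s_1,\dots,s_r)$ and $x=(x_1,\dots,x_n)$; that is, these rational functions are unchanged when any one of the variables $s_1,\dots,s_r,x_1,\dots,x_n$ is increased by $a$.
   Context: Over $\mathbb K$ define $$\Phi_l(s,x)=\kappa\prod_{i=1}^n\frac{s_l-x_i+\Lambda_i}{s_l-x_i+a}\prod_{j\ne l}\frac{(s_l-s_j+a)(s_l-s_j-1)}{(s_l-s_j)(s_l-s_j+1+a)},\qquad \Psi_m(s,x)=\prod_{j=1}^r\frac{s_j-x_m}{s_j-x_m+\Lambda_m-a},$$ and $\tilde\Phi_l(s,x)=\prod_{i=0}^{p-1}\Phi_l(s+iae_l,x)$, $\tilde\Psi_m(s,x)=\prod_{i=0}^{p-1}\Psi_m(s,x+iaf_m)$, where $s+iae_l$ (resp. $x+iaf_m$) is $s$ (resp. $x$) with the $l$-th (resp. $m$-th) coordinate increased by $ia$. -}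

module Defs where

open import Algebra.Apartness.Bundles using (HeytingField; HeytingCommutativeRing)
open import Algebra.Bundles using (CommutativeRing; CommutativeMonoid)
import Algebra.Apartness.Properties.HeytingCommutativeRing as HeytingProperties
import Algebra.Definitions.RawMonoid as RawMonoidDefs
import Algebra.Properties.Group as GroupProperties
import Algebra.Solver.Ring.NaturalCoefficients.Default as SemiringSolver
import Algebra.Properties.Ring as RingProperties
open import Data.Bool.Base using (if_then_else_)
open import Data.Fin.Base using (Fin; zero; suc; toℕ; join; splitAt)
import Data.Fin.Properties as Fin
open import Data.Nat.Base as ℕ using (ℕ; zero; suc)
open import Data.Nat.Divisibility using (_∣_)
open import Data.Product.Base using (_,_; proj₁; proj₂)
open import Data.Sum.Base using (_⊎_; inj₁; inj₂)
import Data.Sum.Properties as Sum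
open import Function.Bundles using (_⇔_)
open import Level using (_⊔_)
open import Relation.Binary.Definitions using (DecidableEquality)
open import Relation.Binary.PropositionalEquality as ≡ using (_≡_; _≢_)
open import Relation.Nullary using (¬_; yes; no; does; Dec; contradiction)
import Relation.Binary.Reasoning.Setoid as SetoidReasoning

-- A HeytingField is the library's notion of a field; classically _#_ is ¬ (_≈_),
-- and membership in K^× reads a # 0#.
module _ {c ℓ₁ ℓ₂} (K : HeytingField c ℓ₁ ℓ₂) where

  open HeytingField K

  fieldRing : CommutativeRing c ℓ₁
  fieldRing = HeytingCommutativeRing.commutativeRing heytingCommutativeRing

  -- The kernel of the canonical map ℤ → K is generated by p.
  HasCharacteristic : ℕ → Set ℓ₁
  HasCharacteristic p = ∀ m → (m · 1# ≈ 0#) ⇔ (p ∣ m)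
    where open RawMonoidDefs (CommutativeRing.+-rawMonoid fieldRing) using () renaming (_×_ to _·_)

-- K[V] as the free commutative K-algebra on V: expressions modulo the
-- congruence generated by the commutative ring laws and by con being a ring
-- homomorphism.
module Polynomials {c ℓ₁ ℓ₂} (K : HeytingField c ℓ₁ ℓ₂) where

  private
    module K = CommutativeRing (fieldRing K)

  infix  8 -_
  infixl 7 _*_
  infixl 6 _+_
  infix  4 _≈_ _≉_

  data Poly (V : Set) : Set c where
    con : K.Carrier → Poly V
    var : V → Poly V
    _+_ : Poly V → Poly V → Poly V
    _*_ : Poly V → Poly V → Poly V
    -_  : Poly V → Poly V

  0# 1# : {V : Set} → Poly V
  0# = con K.0#
  1# = con K.1#

  data _≈_ {V : Set} : Poly V → Poly V → Set (c ⊔ ℓ₁) where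
    refl       : ∀ {t} → t ≈ t
    sym        : ∀ {t u} → t ≈ u → u ≈ t
    trans      : ∀ {t u v} → t ≈ u → u ≈ v → t ≈ v
    +-cong     : ∀ {t t′ u u′} → t ≈ t′ → u ≈ u′ → t + u ≈ t′ + u′
    *-cong     : ∀ {t t′ u u′} → t ≈ t′ → u ≈ u′ → t * u ≈ t′ * u′
    -‿cong     : ∀ {t t′} → t ≈ t′ → - t ≈ - t′
    con-cong   : ∀ {a b} → a K.≈ b → con a ≈ con b
    con-+      : ∀ a b → con (a K.+ b) ≈ con a + con b
    con-*      : ∀ a b → con (a K.* b) ≈ con a * con b
    +-assoc    : ∀ t u v → (t + u) + v ≈ t + (u + v)
    +-comm     : ∀ t u → t + u ≈ u + t
    +-identity : ∀ t → 0# + t ≈ t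
    +-inverse  : ∀ t → - t + t ≈ 0#
    *-assoc    : ∀ t u v → (t * u) * v ≈ t * (u * v)
    *-comm     : ∀ t u → t * u ≈ u * t
    *-identity : ∀ t → 1# * t ≈ t
    distribˡ   : ∀ t u v → t * (u + v) ≈ t * u + t * v

  _≉_ : {V : Set} → Poly V → Poly V → Set (c ⊔ ℓ₁)
  t ≉ u = ¬ (t ≈ u)

  polyRing : Set → CommutativeRing c (c ⊔ ℓ₁)
  polyRing V = record
    { Carrier = Poly V ; _≈_ = _≈_ ; _+_ = _+_ ; _*_ = _*_ ; -_ = -_ ; 0# = 0# ; 1# = 1#
    ; isCommutativeRing = record
      { isRing = record
        { +-isAbelianGroup = record
          { isGroup = record
            { isMonoid = record
              { isSemigroup = record
                { isMagma = record
                  { isEquivalence = record { refl = refl ; sym = sym ; trans = trans }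
                  ; ∙-cong = +-cong }
                ; assoc = +-assoc }
              ; identity = +-identity , λ t → trans (+-comm t 0#) (+-identity t) }
            ; inverse = +-inverse , λ t → trans (+-comm t (- t)) (+-inverse t)
            ; ⁻¹-cong = -‿cong }
          ; comm = +-comm }
        ; *-cong = *-cong
        ; *-assoc = *-assoc
        ; *-identity = *-identity , λ t → trans (*-comm t 1#) (*-identity t)
        ; distrib = distribˡ , λ t u v →
            trans (*-comm (u + v) t)
              (trans (distribˡ t u v) (+-cong (*-comm t u) (*-comm t v))) }
      ; *-comm = *-comm } }

  infixl 6 _-_
  _-_ : {V : Set} → Poly V → Poly V → Poly V
  t - u = t + - u

  con-neg : {V : Set} (a : K.Carrier) → con {V} (K.- a) ≈ - con a
  con-neg {V} a = G.inverseˡ-unique (con (K.- a)) (con a)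
    (trans (sym (con-+ (K.- a) a)) (con-cong (K.-‿inverseˡ a)))
    where module G = GroupProperties (CommutativeRing.+-group (polyRing V))

  module Evaluation
    {d ℓ} (S : CommutativeRing d ℓ) {V : Set}
    (h : K.Carrier → CommutativeRing.Carrier S)
    (h-cong : ∀ {a b} → a K.≈ b → CommutativeRing._≈_ S (h a) (h b))
    (h-+ : ∀ a b → CommutativeRing._≈_ S (h (a K.+ b)) (CommutativeRing._+_ S (h a) (h b)))
    (h-* : ∀ a b → CommutativeRing._≈_ S (h (a K.* b)) (CommutativeRing._*_ S (h a) (h b)))
    (h-0 : CommutativeRing._≈_ S (h K.0#) (CommutativeRing.0# S))
    (h-1 : CommutativeRing._≈_ S (h K.1#) (CommutativeRing.1# S))
    (ρ : V → CommutativeRing.Carrier S)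
    where

    private
      module S = CommutativeRing S

    eval : Poly V → S.Carrier
    eval (con a) = h a
    eval (var v) = ρ v
    eval (t + u) = eval t S.+ eval u
    eval (t * u) = eval t S.* eval u
    eval (- t)   = S.- eval t

    eval-cong : ∀ {t u} → t ≈ u → eval t S.≈ eval u
    eval-cong refl             = S.refl
    eval-cong (sym e)          = S.sym (eval-cong e)
    eval-cong (trans e f)      = S.trans (eval-cong e) (eval-cong f)
    eval-cong (+-cong e f)     = S.+-cong (eval-cong e) (eval-cong f)
    eval-cong (*-cong e f)     = S.*-cong (eval-cong e) (eval-cong f)
    eval-cong (-‿cong e)       = S.-‿cong (eval-cong e)
    eval-cong (con-cong e)     = h-cong e
    eval-cong (con-+ a b)      = h-+ a b
    eval-cong (con-* a b)      = h-* a b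
    eval-cong (+-assoc t u v)  = S.+-assoc _ _ _
    eval-cong (+-comm t u)     = S.+-comm _ _
    eval-cong (+-identity t)   = S.trans (S.+-congʳ h-0) (S.+-identityˡ _)
    eval-cong (+-inverse t)    = S.trans (S.-‿inverseˡ _) (S.sym h-0)
    eval-cong (*-assoc t u v)  = S.*-assoc _ _ _
    eval-cong (*-comm t u)     = S.*-comm _ _
    eval-cong (*-identity t)   = S.trans (S.*-congʳ h-1) (S.*-identityˡ _)
    eval-cong (distribˡ t u v) = S.distribˡ _ _ _

  module _ {V : Set} (ρ : V → K.Carrier) where
    open Evaluation (fieldRing K) (λ a → a) (λ e → e)
      (λ _ _ → K.refl) (λ _ _ → K.refl) K.refl K.refl ρ
      public using () renaming (eval to evaluate; eval-cong to evaluate-cong)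

  module _ {V W : Set} (ρ : V → Poly W) where
    open Evaluation (polyRing W) con con-cong con-+ con-* refl refl ρ
      public using () renaming (eval to substitute; eval-cong to substitute-cong)

  substitute-inverse : {V W : Set} (ρ : V → Poly W) (σ : W → Poly V) →
    (∀ v → substitute σ (ρ v) ≈ var v) → ∀ t → substitute σ (substitute ρ t) ≈ t
  substitute-inverse ρ σ inv (con a) = refl
  substitute-inverse ρ σ inv (var v) = inv v
  substitute-inverse ρ σ inv (t + u) = +-cong (substitute-inverse ρ σ inv t) (substitute-inverse ρ σ inv u)
  substitute-inverse ρ σ inv (t * u) = *-cong (substitute-inverse ρ σ inv t) (substitute-inverse ρ σ inv u)
  substitute-inverse ρ σ inv (- t)   = -‿cong (substitute-inverse ρ σ inv t)

  NoZeroDivisors : Set → Set (c ⊔ ℓ₁)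
  NoZeroDivisors V = ∀ (t u : Poly V) → t ≉ 0# → u ≉ 0# → t * u ≉ 0#

  Stable₀ : Set → Set (c ⊔ ℓ₁)
  Stable₀ V = ∀ (t : Poly V) → ¬ t ≉ 0# → t ≈ 0#

  private
    module Solve {V : Set} = SemiringSolver (CommutativeRing.commutativeSemiring (polyRing V))
    module P {V : Set} = CommutativeRing (polyRing V)
    module PR {V : Set} = RingProperties (P.ring {V})
    module ≈-Reasoning {V : Set} = SetoidReasoning (P.setoid {V})

  -- For a polynomial t in X = var zero and further variables, t ≈ e t + X * δ t,
  -- where e sets X to 0.  Dividing out powers of X until the constant terms of
  -- both factors are nonzero reduces to one variable less.
  private
    module _ {N : ℕ} where

      X : Poly (Fin (suc N))
      X = var zero

      drop : Poly (Fin (suc N)) → Poly (Fin N)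
      drop = substitute λ { zero → 0# ; (suc i) → var i }

      weaken : Poly (Fin N) → Poly (Fin (suc N))
      weaken = substitute λ i → var (suc i)

      e : Poly (Fin (suc N)) → Poly (Fin (suc N))
      e t = weaken (drop t)

      e-cong : ∀ {t u} → t ≈ u → e t ≈ e u
      e-cong eq = substitute-cong _ (substitute-cong _ eq)

      δ : Poly (Fin (suc N)) → Poly (Fin (suc N))
      δ (con a)       = 0#
      δ (var zero)    = 1#
      δ (var (suc i)) = 0#
      δ (t + u)       = δ t + δ u
      δ (t * u)       = δ t * u + e t * δ u
      δ (- t)         = - δ t

      decompose : ∀ t → t ≈ e t + X * δ t
      decompose (con a) = sym (trans (+-cong refl (P.zeroʳ X)) (P.+-identityʳ _))
      decompose (var zero) = sym (trans (+-identity _) (P.*-identityʳ X))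
      decompose (var (suc i)) = sym (trans (+-cong refl (P.zeroʳ X)) (P.+-identityʳ _))
      decompose (t + u) = begin
        t + u                                 ≈⟨ +-cong (decompose t) (decompose u) ⟩
        (e t + X * δ t) + (e u + X * δ u)     ≈⟨ rearrange (e t) (e u) X (δ t) (δ u) ⟩
        (e t + e u) + X * (δ t + δ u)         ∎
        where
        open ≈-Reasoning
        rearrange : ∀ a b x c d → (a + x * c) + (b + x * d) ≈ (a + b) + x * (c + d)
        rearrange = Solve.solve 5
          (λ a b x c d → ((a :+ x :* c) :+ (b :+ x :* d)) := ((a :+ b) :+ x :* (c :+ d))) refl
          where open Solve
      decompose (t * u) = begin
        t * u                                   ≈⟨ *-cong (decompose t) refl ⟩
        (e t + X * δ t) * u                     ≈⟨ P.distribʳ _ _ _ ⟩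
        e t * u + (X * δ t) * u                 ≈⟨ +-cong (*-cong refl (decompose u)) refl ⟩
        e t * (e u + X * δ u) + (X * δ t) * u   ≈⟨ rearrange (e t) (e u) X (δ t) (δ u) u ⟩
        e t * e u + X * (δ t * u + e t * δ u)   ∎
        where
        open ≈-Reasoning
        rearrange : ∀ a b x c d u → a * (b + x * d) + (x * c) * u ≈ a * b + x * (c * u + a * d)
        rearrange = Solve.solve 6
          (λ a b x c d u → (a :* (b :+ x :* d) :+ (x :* c) :* u) := (a :* b :+ x :* (c :* u :+ a :* d))) refl
          where open Solve
      decompose (- t) = begin
        - t                       ≈⟨ -‿cong (decompose t) ⟩
        - (e t + X * δ t)         ≈⟨ PR.-‿+-comm (e t) (X * δ t) ⟨
        - e t + - (X * δ t)       ≈⟨ +-cong refl (PR.-‿distribʳ-* X (δ t)) ⟩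
        - e t + X * - δ t         ∎
        where open ≈-Reasoning

      δ-cong : ∀ {t u} → t ≈ u → δ t ≈ δ u
      δ-cong refl           = refl
      δ-cong (sym p)        = sym (δ-cong p)
      δ-cong (trans p q)    = trans (δ-cong p) (δ-cong q)
      δ-cong (+-cong p q)   = +-cong (δ-cong p) (δ-cong q)
      δ-cong (*-cong p q)   = +-cong (*-cong (δ-cong p) q) (*-cong (e-cong p) (δ-cong q))
      δ-cong (-‿cong p)     = -‿cong (δ-cong p)
      δ-cong (con-cong p)   = refl
      δ-cong (con-+ a b)    = sym (+-identity 0#)
      δ-cong (con-* a b)    = sym (trans (+-cong (P.zeroˡ _) (P.zeroʳ _)) (+-identity 0#))
      δ-cong (+-assoc t u v) = +-assoc _ _ _
      δ-cong (+-comm t u)   = +-comm _ _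
      δ-cong (+-identity t) = +-identity _
      δ-cong (+-inverse t)  = +-inverse _
      δ-cong (*-assoc t u v) = rearrange (δ t) u v (e t) (δ u) (e u) (δ v)
        where
        rearrange : ∀ a u v b c d f →
          (a * u + b * c) * v + (b * d) * f ≈ a * (u * v) + b * (c * v + d * f)
        rearrange = Solve.solve 7
          (λ a u v b c d f →
            ((a :* u :+ b :* c) :* v :+ (b :* d) :* f) := (a :* (u :* v) :+ b :* (c :* v :+ d :* f))) refl
          where open Solve
      δ-cong (*-comm t u) = begin
        δ t * u + e t * δ u                   ≈⟨ +-cong (*-cong refl (decompose u)) refl ⟩
        δ t * (e u + X * δ u) + e t * δ u     ≈⟨ rearrange (δ t) (e u) X (δ u) (e t) ⟩
        δ u * (e t + X * δ t) + e u * δ t     ≈⟨ +-cong (*-cong refl (decompose t)) refl ⟨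
        δ u * t + e u * δ t                   ∎
        where
        open ≈-Reasoning
        rearrange : ∀ a b x d f → a * (b + x * d) + f * d ≈ d * (f + x * a) + b * a
        rearrange = Solve.solve 5
          (λ a b x d f → (a :* (b :+ x :* d) :+ f :* d) := (d :* (f :+ x :* a) :+ b :* a)) refl
          where open Solve
      δ-cong (*-identity t) = trans (+-cong (P.zeroˡ t) (*-identity (δ t))) (+-identity _)
      δ-cong (distribˡ t u v) = rearrange (δ t) u v (e t) (δ u) (δ v)
        where
        rearrange : ∀ a u v b c d →
          a * (u + v) + b * (c + d) ≈ (a * u + b * c) + (a * v + b * d)
        rearrange = Solve.solve 6
          (λ a u v b c d →
            (a :* (u :+ v) :+ b :* (c :+ d)) := ((a :* u :+ b :* c) :+ (a :* v :+ b :* d))) refl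
          where open Solve

      δ-weaken : ∀ t → δ (weaken t) ≈ 0#
      δ-weaken (con a) = refl
      δ-weaken (var i) = refl
      δ-weaken (t + u) = trans (+-cong (δ-weaken t) (δ-weaken u)) (+-identity 0#)
      δ-weaken (t * u) = trans
        (+-cong (trans (*-cong (δ-weaken t) refl) (P.zeroˡ _))
                (trans (*-cong refl (δ-weaken u)) (P.zeroʳ _)))
        (+-identity 0#)
      δ-weaken (- t)   = trans (-‿cong (δ-weaken t)) PR.-0#≈0#

      X-regular : ∀ t → X * t ≈ 0# → t ≈ 0#
      X-regular t Xt≈0 = begin
        t                   ≈⟨ trans (+-cong (*-identity t) (P.zeroˡ (δ t))) (P.+-identityʳ t) ⟨
        δ (X * t)           ≈⟨ δ-cong Xt≈0 ⟩
        0#                  ∎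
        where open ≈-Reasoning

      DegreeBelow : ℕ → Poly (Fin (suc N)) → Set (c ⊔ ℓ₁)
      DegreeBelow zero    t = t ≈ 0#
      DegreeBelow (suc k) t = DegreeBelow k (δ t)

      below-resp : ∀ k {t u} → t ≈ u → DegreeBelow k t → DegreeBelow k u
      below-resp zero    p t≈0 = trans (sym p) t≈0
      below-resp (suc k) p d   = below-resp k (δ-cong p) d

      below-0 : ∀ k → DegreeBelow k 0#
      below-0 zero    = refl
      below-0 (suc k) = below-0 k

      below-+ : ∀ k {t u} → DegreeBelow k t → DegreeBelow k u → DegreeBelow k (t + u)
      below-+ zero    p q = trans (+-cong p q) (+-identity 0#)
      below-+ (suc k) p q = below-+ k p q

      below-neg : ∀ k {t} → DegreeBelow k t → DegreeBelow k (- t)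
      below-neg zero    p = trans (-‿cong p) PR.-0#≈0#
      below-neg (suc k) p = below-neg k p

      below-step : ∀ k {t} → DegreeBelow k t → DegreeBelow (suc k) t
      below-step zero    p = δ-cong p
      below-step (suc k) p = below-step k p

      below-raiseˡ : ∀ m {k t} → DegreeBelow k t → DegreeBelow (m ℕ.+ k) t
      below-raiseˡ zero    p = p
      below-raiseˡ (suc m) p = below-step (m ℕ.+ _) (below-raiseˡ m p)

      below-raiseʳ : ∀ m k {t} → DegreeBelow k t → DegreeBelow (k ℕ.+ m) t
      below-raiseʳ m zero    p = below-resp m (sym p) (below-0 m)
      below-raiseʳ m (suc k) p = below-raiseʳ m k p

      below-weaken-* : ∀ k w {t} → DegreeBelow k t → DegreeBelow k (weaken w * t)
      below-weaken-* zero    w p = trans (*-cong refl p) (P.zeroʳ _)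
      below-weaken-* (suc k) w {t} p = below-resp k
        (sym (trans (+-cong (trans (*-cong (δ-weaken w) refl) (P.zeroˡ t)) refl) (+-identity _)))
        (below-weaken-* k (drop (weaken w)) p)

      below-* : ∀ m k {t u} → DegreeBelow m t → DegreeBelow k u → DegreeBelow (m ℕ.+ k) (t * u)
      below-* zero k {u = u} p q =
        below-resp k (sym (trans (*-cong p refl) (P.zeroˡ u))) (below-0 k)
      below-* (suc m) zero {t} p q =
        below-resp (suc m ℕ.+ 0) (sym (trans (*-cong refl q) (P.zeroʳ t))) (below-0 (suc m ℕ.+ 0))
      below-* (suc m) (suc k) {t} p q = below-+ (m ℕ.+ suc k)
        (below-* m (suc k) p q)
        (below-raiseˡ m (below-step k (below-weaken-* k (drop t) q)))

      degree : Poly (Fin (suc N)) → ℕ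
      degree (con a) = 1
      degree (var v) = 2
      degree (t + u) = degree t ℕ.+ degree u
      degree (t * u) = degree t ℕ.+ degree u
      degree (- t)   = degree t

      below-degree : ∀ t → DegreeBelow (degree t) t
      below-degree (con a) = refl
      below-degree (var zero) = refl
      below-degree (var (suc i)) = refl
      below-degree (t + u) = below-+ (degree t ℕ.+ degree u)
        (below-raiseʳ (degree u) (degree t) (below-degree t))
        (below-raiseˡ (degree t) (below-degree u))
      below-degree (t * u) = below-* (degree t) (degree u) (below-degree t) (below-degree u)
      below-degree (- t) = below-neg (degree t) (below-degree t)

      -- t ≈ X * δ t once the constant term vanishes
      divide : ∀ t → drop t ≈ 0# → t ≈ X * δ t
      divide t p = trans (decompose t) (trans (+-cong (substitute-cong _ p) refl) (+-identity _))

      step : NoZeroDivisors (Fin N) → NoZeroDivisors (Fin (suc N))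
      step ih t₀ u₀ t₀≉0 u₀≉0 =
        go (degree t₀) (degree u₀) t₀ u₀ (below-degree t₀) (below-degree u₀) t₀≉0 u₀≉0
        where
        go : ∀ m k t u → DegreeBelow m t → DegreeBelow k u → t ≉ 0# → u ≉ 0# → t * u ≉ 0#
        go zero    k       t u dt du t≉0 u≉0 tu≈0 = t≉0 dt
        go (suc m) zero    t u dt du t≉0 u≉0 tu≈0 = u≉0 du
        go (suc m) (suc k) t u dt du t≉0 u≉0 tu≈0 =
          ih (drop t) (drop u) drop-t≉0 drop-u≉0 (substitute-cong _ tu≈0)
          where
          drop-t≉0 : drop t ≉ 0#
          drop-t≉0 p = go m (suc k) (δ t) u dt du
            (λ q → t≉0 (trans (divide t p) (trans (*-cong refl q) (P.zeroʳ X))))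
            u≉0
            (X-regular (δ t * u)
              (trans (sym (*-assoc X (δ t) u)) (trans (*-cong (sym (divide t p)) refl) tu≈0)))

          drop-u≉0 : drop u ≉ 0#
          drop-u≉0 p = go (suc m) k t (δ u) dt du t≉0
            (λ q → u≉0 (trans (divide u p) (trans (*-cong refl q) (P.zeroʳ X))))
            (X-regular (t * δ u)
              (trans (sym (*-assoc X t (δ u)))
                (trans (*-cong (*-comm X t) refl)
                  (trans (*-assoc t X (δ u)) (trans (*-cong refl (sym (divide u p))) tu≈0)))))

      step-stable : Stable₀ (Fin N) → Stable₀ (Fin (suc N))
      step-stable ih t₀ = go (degree t₀) t₀ (below-degree t₀)
        where
        go : ∀ k t → DegreeBelow k t → ¬ t ≉ 0# → t ≈ 0#
        go zero    t dt ¬¬p = dt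
        go (suc k) t dt ¬¬p = trans (divide t drop-t≈0) (trans (*-cong refl δt≈0) (P.zeroʳ X))
          where
          drop-t≈0 : drop t ≈ 0#
          drop-t≈0 = ih (drop t) λ ¬p → ¬¬p λ p → ¬p (substitute-cong _ p)

          δt≈0 : δ t ≈ 0#
          δt≈0 = go k (δ t) dt λ ¬p → ¬¬p λ p → ¬p (δ-cong p)

    module F = HeytingField K
    module FP = HeytingProperties F.heytingCommutativeRing

    constant : (ρ : Fin 0 → K.Carrier) → ∀ t → t ≈ con (evaluate ρ t)
    constant ρ (con a) = refl
    constant ρ (t + u) = trans (+-cong (constant ρ t) (constant ρ u)) (sym (con-+ _ _))
    constant ρ (t * u) = trans (*-cong (constant ρ t) (constant ρ u)) (sym (con-* _ _))
    constant ρ (- t)   = trans (-‿cong (constant ρ t)) (sym (con-neg _))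

    base : NoZeroDivisors (Fin 0)
    base t u t≉0 u≉0 tu≈0 = apart t≉0 λ t#0 → apart u≉0 λ u#0 →
      F.#-irrefl K.refl (FP.#-congʳ (evaluate-cong ρ tu≈0) (FP.x#0y#0→xy#0 t#0 u#0))
      where
      ρ : Fin 0 → K.Carrier
      ρ ()

      apart : ∀ {t} → t ≉ 0# → ¬ ¬ (evaluate ρ t F.# K.0#)
      apart {t} t≉0 ¬# = t≉0 (trans (constant ρ t) (con-cong (F.tight _ _ .proj₁ ¬#)))

    noZeroDivisors-Fin : ∀ N → NoZeroDivisors (Fin N)
    noZeroDivisors-Fin zero    = base
    noZeroDivisors-Fin (suc N) = step (noZeroDivisors-Fin N)

    stable-Fin : ∀ N → Stable₀ (Fin N)
    stable-Fin zero    t ¬¬p = trans (constant ρ t) (con-cong (F.tight _ _ .proj₁ λ t#0 →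
      ¬¬p λ p → F.#-irrefl K.refl (FP.#-congʳ (evaluate-cong ρ p) t#0)))
      where
      ρ : Fin 0 → K.Carrier
      ρ ()
    stable-Fin (suc N) = step-stable (stable-Fin N)

  1≉0 : ∀ {V} → 1# {V} ≉ 0#
  1≉0 p = F.#-irrefl K.refl (FP.#-congʳ (evaluate-cong (λ _ → K.0#) p) FP.1#0)

  substitute-≉0 : ∀ {V W} (ρ : V → Poly W) (σ : W → Poly V) →
    (∀ v → substitute σ (ρ v) ≈ var v) → ∀ {t} → t ≉ 0# → substitute ρ t ≉ 0#
  substitute-≉0 ρ σ inv {t} t≉0 p =
    t≉0 (trans (sym (substitute-inverse ρ σ inv t)) (substitute-cong σ p))

  module _ (r n : ℕ) where
    private
      ρ : Fin r ⊎ Fin n → Poly (Fin (r ℕ.+ n))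
      ρ v = var (join r n v)

      σ : Fin (r ℕ.+ n) → Poly (Fin r ⊎ Fin n)
      σ i = var (splitAt r i)

      inv : ∀ v → substitute σ (ρ v) ≈ var v
      inv v = P.reflexive (≡.cong var (Fin.splitAt-join r n v))

    noZeroDivisors : NoZeroDivisors (Fin r ⊎ Fin n)
    noZeroDivisors t u t≉0 u≉0 tu≈0 =
      noZeroDivisors-Fin (r ℕ.+ n) (substitute ρ t) (substitute ρ u)
        (substitute-≉0 ρ σ inv t≉0) (substitute-≉0 ρ σ inv u≉0) (substitute-cong ρ tu≈0)

    stable : Stable₀ (Fin r ⊎ Fin n)
    stable t ¬¬p = trans (sym (substitute-inverse ρ σ inv t))
      (substitute-cong σ (stable-Fin (r ℕ.+ n) (substitute ρ t)
        λ ¬p → ¬¬p λ p → ¬p (substitute-cong ρ p)))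

  linear≉0 : ∀ {V} → DecidableEquality V → {v w : V} → v ≢ w → ∀ b →
    var v - var w + con b ≉ 0#
  linear≉0 _≟_ {v} {w} v≢w b p = 1≉0 {Fin 0} (con-cong (K.trans (K.sym value) (evaluate-cong ρ p)))
    where
    ρ : _ → K.Carrier
    ρ u = if does (u ≟ v) then K.1# K.- b else K.0#

    module KR = RingProperties K.ring
    open SetoidReasoning K.setoid

    ρv : ρ v K.≈ K.1# K.- b
    ρv with v ≟ v
    ... | yes _   = K.refl
    ... | no v≢v = contradiction ≡.refl v≢v

    ρw : ρ w K.≈ K.0#
    ρw with w ≟ v
    ... | yes w≡v = contradiction (≡.sym w≡v) v≢w
    ... | no _    = K.refl

    value : evaluate ρ (var v - var w + con b) K.≈ K.1#
    value = begin
      ρ v K.- ρ w K.+ b                ≈⟨ K.+-congʳ (K.+-cong ρv (K.trans (K.-‿cong ρw) KR.-0#≈0#)) ⟩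
      (K.1# K.- b) K.+ K.0# K.+ b      ≈⟨ K.+-congʳ (K.+-identityʳ _) ⟩
      K.1# K.- b K.+ b                 ≈⟨ K.+-assoc _ _ _ ⟩
      K.1# K.+ (K.- b K.+ b)           ≈⟨ K.+-congˡ (K.-‿inverseˡ b) ⟩
      K.1# K.+ K.0#                    ≈⟨ K.+-identityʳ _ ⟩
      K.1#                             ∎

-- The field K(s₁,…,s_r,x₁,…,x_n) as a setoid with its multiplication.
module RationalFunctions {c ℓ₁ ℓ₂} (K : HeytingField c ℓ₁ ℓ₂) (r n : ℕ) where

  open Polynomials K
  private
    module K = CommutativeRing (fieldRing K)
    module P = CommutativeRing (polyRing (Fin r ⊎ Fin n))
    module PR = RingProperties P.ring
    module Solve = SemiringSolver P.commutativeSemiring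

  Variable : Set
  Variable = Fin r ⊎ Fin n

  _≟ᵥ_ : DecidableEquality Variable
  _≟ᵥ_ = Sum.≡-dec Fin._≟_ Fin._≟_

  s : Fin r → Poly Variable
  s l = var (inj₁ l)

  x : Fin n → Poly Variable
  x i = var (inj₂ i)

  infix 5 _/_[_]
  record Rational : Set (c ⊔ ℓ₁) where
    constructor _/_[_]
    field
      numerator     : Poly Variable
      denominator   : Poly Variable
      denominator≉0 : denominator ≉ 0#

  open Rational public

  infix 4 _≃_
  _≃_ : Rational → Rational → Set (c ⊔ ℓ₁)
  f ≃ g = numerator f * denominator g ≈ numerator g * denominator f

  infixl 7 _∙_
  _∙_ : Rational → Rational → Rational
  (t / d [ d≉0 ]) ∙ (u / e [ e≉0 ]) = t * u / d * e [ noZeroDivisors r n d e d≉0 e≉0 ]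

  1ᵣ : Rational
  1ᵣ = 1# / 1# [ 1≉0 ]

  *-cancelʳ : ∀ {d} → d ≉ 0# → ∀ {t u} → t * d ≈ u * d → t ≈ u
  *-cancelʳ {d} d≉0 {t} {u} p =
    PR.x∙y⁻¹≈ε⇒x≈y t u (stable r n (t - u) λ t-u≉0 →
      noZeroDivisors r n (t - u) d t-u≉0 d≉0
        (trans (PR.[y-z]x≈yx-zx d t u) (PR.x≈y⇒x∙y⁻¹≈ε p)))

  private
    swapʳ : ∀ a b c → a * b * c ≈ a * c * b
    swapʳ = Solve.solve 3 (λ a b c → a :* b :* c := a :* c :* b) refl
      where open Solve

    interchange : ∀ a b c d → (a * b) * (c * d) ≈ (a * c) * (b * d)
    interchange = Solve.solve 4 (λ a b c d → (a :* b) :* (c :* d) := (a :* c) :* (b :* d)) refl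
      where open Solve

  ≃-trans : ∀ {f g h} → f ≃ g → g ≃ h → f ≃ h
  ≃-trans {t / d [ _ ]} {u / e [ e≉0 ]} {v / k [ _ ]} p q = *-cancelʳ e≉0 (begin
    t * k * e    ≈⟨ swapʳ t k e ⟩
    t * e * k    ≈⟨ *-cong p refl ⟩
    u * d * k    ≈⟨ swapʳ u d k ⟩
    u * k * d    ≈⟨ *-cong q refl ⟩
    v * e * d    ≈⟨ swapʳ v e d ⟩
    v * d * e    ∎)
    where open SetoidReasoning P.setoid

  ∙-commutativeMonoid : CommutativeMonoid (c ⊔ ℓ₁) (c ⊔ ℓ₁)
  ∙-commutativeMonoid = record
    { Carrier = Rational ; _≈_ = _≃_ ; _∙_ = _∙_ ; ε = 1ᵣ
    ; isCommutativeMonoid = record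
      { isMonoid = record
        { isSemigroup = record
          { isMagma = record
            { isEquivalence = record
              { refl = refl
              ; sym = sym
              ; trans = λ {f} {g} {h} → ≃-trans {f} {g} {h} }
            ; ∙-cong = λ p q →
                trans (interchange _ _ _ _) (trans (*-cong p q) (interchange _ _ _ _)) }
          ; assoc = λ f g h → *-cong (*-assoc _ _ _) (sym (*-assoc _ _ _)) }
        ; identity = (λ f → *-cong (*-identity _) (sym (*-identity _)))
                   , (λ f → *-cong (P.*-identityʳ _) (sym (P.*-identityʳ _))) }
      ; comm = λ f g → *-cong (*-comm _ _) (*-comm _ _) } }

  open RawMonoidDefs (CommutativeMonoid.rawMonoid ∙-commutativeMonoid) public
    using () renaming (sum to ∏)

  shiftVariable : Variable → K.Carrier → Variable → Poly Variable
  shiftVariable v b w = if does (w ≟ᵥ v) then var w + con b else var w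

  shiftVariable-inverse : ∀ v b w →
    substitute (shiftVariable v (K.- b)) (shiftVariable v b w) ≈ var w
  shiftVariable-inverse v b w with w ≟ᵥ v in eq
  ... | no _  rewrite eq = refl
  ... | yes _ rewrite eq = begin
    var w + con (K.- b) + con b      ≈⟨ +-assoc _ _ _ ⟩
    var w + (con (K.- b) + con b)    ≈⟨ +-cong refl (con-+ _ _) ⟨
    var w + con (K.- b K.+ b)        ≈⟨ +-cong refl (con-cong (K.-‿inverseˡ b)) ⟩
    var w + 0#                       ≈⟨ P.+-identityʳ _ ⟩
    var w                            ∎
    where open SetoidReasoning P.setoid

  -- The K-automorphism of K(s,x) increasing the variable v by b.
  shift : Variable → K.Carrier → Rational → Rational
  shift v b (t / d [ d≉0 ]) =
    substitute (shiftVariable v b) t / substitute (shiftVariable v b) d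
      [ substitute-≉0 _ (shiftVariable v (K.- b)) (shiftVariable-inverse v b) d≉0 ]

  shift-cong : ∀ v b {f g} → f ≃ g → shift v b f ≃ shift v b g
  shift-cong v b = substitute-cong (shiftVariable v b)

module ScalarPCurvature
  {c ℓ₁ ℓ₂} (K : HeytingField c ℓ₁ ℓ₂) (p n r : ℕ)
  (a κ : HeytingField.Carrier K) (Λ : Fin n → HeytingField.Carrier K)
  where

  open Polynomials K
  open RationalFunctions K r n
  private
    module K = CommutativeRing (fieldRing K)
    module P = CommutativeRing (polyRing Variable)

    open RawMonoidDefs K.+-rawMonoid using () renaming (_×_ to _·_)

    inj₁≢inj₂ : ∀ j i → _≢_ {A = Variable} (inj₁ j) (inj₂ i)
    inj₁≢inj₂ j i ()

    linear : ∀ {v w} → v ≢ w → ∀ b {t} → t ≈ var v - var w + con b → t ≉ 0#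
    linear v≢w b p t≈0 = linear≉0 _≟ᵥ_ v≢w b (trans (sym p) t≈0)

    product≉0 : ∀ {t u} → t ≉ 0# → u ≉ 0# → t * u ≉ 0#
    product≉0 = noZeroDivisors r n _ _

    con-sum : ∀ (t : Poly Variable) b d → t + con b + con d ≈ t + con (b K.+ d)
    con-sum t b d = trans (+-assoc _ _ _) (+-cong refl (sym (con-+ b d)))

  Φ-x-factor : Fin r → Fin n → Rational
  Φ-x-factor l i = (s l - x i + con (Λ i)) / (s l - x i + con a) [ linear (inj₁≢inj₂ l i) a refl ]

  -- The factor j = l is omitted from the product over j.
  Φ-s-factor : (l j : Fin r) → Dec (j ≡ l) → Rational
  Φ-s-factor l j (yes _)  = 1ᵣ
  Φ-s-factor l j (no j≢l) =
    (s l - s j + con a) * (s l - s j - 1#) / (s l - s j) * (s l - s j + 1# + con a)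
      [ product≉0 (linear l≢j K.0# (sym (P.+-identityʳ _)))
                  (linear l≢j (K.1# K.+ a) (con-sum _ _ _)) ]
    where
    l≢j : _≢_ {A = Variable} (inj₁ l) (inj₁ j)
    l≢j ≡.refl = j≢l ≡.refl

  Φ : Fin r → Rational
  Φ l = (con κ / 1# [ 1≉0 ])
      ∙ ∏ (λ i → Φ-x-factor l i)
      ∙ ∏ (λ j → Φ-s-factor l j (j Fin.≟ l))

  Ψ : Fin n → Rational
  Ψ m = ∏ λ j →
    (s j - x m) / (s j - x m + con (Λ m) - con a)
      [ linear (inj₁≢inj₂ j m) (Λ m K.- a)
          (trans (+-cong refl (sym (con-neg a))) (con-sum _ _ _)) ]

  Φ̃ : Fin r → Rational
  Φ̃ l = ∏ λ (i : Fin p) → shift (inj₁ l) (toℕ i · a) (Φ l)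

  Ψ̃ : Fin n → Rational
  Ψ̃ m = ∏ λ (i : Fin p) → shift (inj₂ m) (toℕ i · a) (Ψ m)

{-# OPTIONS --safe #-}

-- The function Φ̃_l is the product of Φ_l over the orbit of the shift of s_l by a,
-- which is cyclic since p a = 0; hence it is a-periodic in s_l.  Each
-- factor of Φ_l is constant or depends only on a difference s_l − w for another
-- variable w.  Increasing w by a undoes increasing s_l by a on such a factor, so it
-- also permutes the orbit product cyclically, and all remaining variables fix the
-- factor.  The same argument applies to Ψ̃_m and x_m.
module Submission where

open import Defs
open import Algebra.Apartness.Bundles using (HeytingField)
open import Algebra.Bundles using (CommutativeMonoid; CommutativeRing; Semiring)
import Algebra.Definitions.RawMonoid as RawMonoidDefs
import Algebra.Properties.CommutativeMonoid.Sum as Sum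
import Algebra.Properties.Ring as RingProperties
import Algebra.Properties.Semiring.Mult as SemiringMult
open import Data.Bool.Base using (if_then_else_)
open import Data.Fin.Base using (Fin; zero; suc; toℕ; inject₁; fromℕ)
import Data.Fin.Properties as Fin
open import Data.Nat.Base using (ℕ; zero; suc; _<_; _≤_)
open import Data.Nat.Divisibility using (∣-refl)
open import Data.Product.Base using (_×_; _,_)
open import Data.Sum.Base using (_⊎_; inj₁; inj₂)
open import Data.Unit.Base using (⊤; tt)
open import Function.Base using (_∘_; _$_)
open import Function.Bundles using (Equivalence)
open import Relation.Binary.PropositionalEquality as ≡ using (_≡_; _≢_)
import Relation.Binary.Reasoning.Setoid as SetoidReasoning
open import Relation.Nullary using (Dec; yes; no)
open import Relation.Nullary.Decidable using (dec-true; dec-false)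

module _ {c ℓ} (R : Semiring c ℓ) where

  open Semiring R
  open SemiringMult R using (×-congʳ; ×-assoc-*) renaming (_×_ to _·_)
  open SetoidReasoning setoid

  ·1≈0⇒·≈0 : ∀ p → p · 1# ≈ 0# → ∀ b → p · b ≈ 0#
  ·1≈0⇒·≈0 p p·1≈0 b = begin
    p · b           ≈⟨ ×-congʳ p (*-identityˡ b) ⟨
    p · (1# * b)    ≈⟨ ×-assoc-* p 1# b ⟨
    (p · 1#) * b    ≈⟨ *-congʳ p·1≈0 ⟩
    0# * b          ≈⟨ zeroˡ b ⟩
    0#              ∎

module _ {c ℓ₁ ℓ₂} (K : HeytingField c ℓ₁ ℓ₂) where

  open Polynomials K

  substitute-∘ : {U V W : Set} (σ : V → Poly W) (ρ : U → Poly V) →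
    ∀ t → substitute σ (substitute ρ t) ≡ substitute (substitute σ ∘ ρ) t
  substitute-∘ σ ρ (con b) = ≡.refl
  substitute-∘ σ ρ (var v) = ≡.refl
  substitute-∘ σ ρ (t + u) = ≡.cong₂ _+_ (substitute-∘ σ ρ t) (substitute-∘ σ ρ u)
  substitute-∘ σ ρ (t * u) = ≡.cong₂ _*_ (substitute-∘ σ ρ t) (substitute-∘ σ ρ u)
  substitute-∘ σ ρ (- t)   = ≡.cong -_ (substitute-∘ σ ρ t)

  substitute-cong-var : {V W : Set} {ρ σ : V → Poly W} →
    (∀ v → ρ v ≈ σ v) → ∀ t → substitute ρ t ≈ substitute σ t
  substitute-cong-var ρ≈σ (con b) = refl
  substitute-cong-var ρ≈σ (var v) = ρ≈σ v
  substitute-cong-var ρ≈σ (t + u) = +-cong (substitute-cong-var ρ≈σ t) (substitute-cong-var ρ≈σ u)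
  substitute-cong-var ρ≈σ (t * u) = *-cong (substitute-cong-var ρ≈σ t) (substitute-cong-var ρ≈σ u)
  substitute-cong-var ρ≈σ (- t)   = -‿cong (substitute-cong-var ρ≈σ t)

  module _ {W : Set} where

    private
      module P = CommutativeRing (polyRing W)
      module PR = RingProperties P.ring

    substitute-∘-cong : {U V : Set} {σ : V → Poly W} {ρ : U → Poly V} {τ : U → Poly W} →
      (∀ u → substitute σ (ρ u) ≈ τ u) → ∀ t → substitute σ (substitute ρ t) ≈ substitute τ t
    substitute-∘-cong στ t =
      trans (P.reflexive (substitute-∘ _ _ t)) (substitute-cong-var στ t)

    +-swapʳ : ∀ (t u v : Poly W) → t + u + v ≈ t + v + u
    +-swapʳ t u v = trans (+-assoc _ _ _) (trans (+-cong refl (+-comm _ _)) (sym (+-assoc _ _ _)))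

    difference-+ʳ : ∀ (t u v : Poly W) → (t + v) - (u + v) ≈ t - u
    difference-+ʳ t u v = begin
      (t + v) + - (u + v)        ≈⟨ +-cong refl (PR.-‿+-comm u v) ⟨
      (t + v) + (- u + - v)      ≈⟨ +-cong refl (+-comm _ _) ⟩
      (t + v) + (- v + - u)      ≈⟨ +-assoc _ _ _ ⟩
      t + (v + (- v + - u))      ≈⟨ +-cong refl (+-assoc _ _ _) ⟨
      t + (v + - v + - u)        ≈⟨ +-cong refl (+-cong (P.-‿inverseʳ v) refl) ⟩
      t + (0# + - u)             ≈⟨ +-cong refl (+-identity _) ⟩
      t - u                      ∎
      where
      open SetoidReasoning P.setoid

  module Shifts (r n : ℕ) where

    open RationalFunctions K r n
    private
      module K = CommutativeRing (fieldRing K)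
      module P = CommutativeRing (polyRing (Fin r ⊎ Fin n))

    module M = CommutativeMonoid ∙-commutativeMonoid

    shiftₚ : Variable → K.Carrier → Poly Variable → Poly Variable
    shiftₚ v b = substitute (shiftVariable v b)

    shiftₚ-same : ∀ v b → shiftₚ v b (var v) ≡ var v + con b
    shiftₚ-same v b = ≡.cong (if_then var v + con b else var v) (dec-true (v ≟ᵥ v) ≡.refl)

    shiftₚ-other : ∀ {v w} b → w ≢ v → shiftₚ v b (var w) ≡ var w
    shiftₚ-other {v} {w} b w≢v = ≡.cong (if_then var w + con b else var w) (dec-false (w ≟ᵥ v) w≢v)

    shiftₚ-comm : ∀ v w b d t → shiftₚ v b (shiftₚ w d t) ≈ shiftₚ w d (shiftₚ v b t)
    shiftₚ-comm v w b d t = trans (substitute-∘-cong on-var t)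
      (P.reflexive (≡.sym (substitute-∘ _ _ t)))
      where
      on-var : ∀ u → shiftₚ v b (shiftVariable w d u) ≈ shiftₚ w d (shiftVariable v b u)
      on-var u with u ≟ᵥ v in eqv | u ≟ᵥ w in eqw
      ... | yes _ | yes _ rewrite eqv | eqw = +-swapʳ _ _ _
      ... | yes _ | no _  rewrite eqv | eqw = refl
      ... | no _  | yes _ rewrite eqv | eqw = refl
      ... | no _  | no _  rewrite eqv | eqw = refl

    shiftₚ-+ : ∀ v b d t → shiftₚ v b (shiftₚ v d t) ≈ shiftₚ v (b K.+ d) t
    shiftₚ-+ v b d = substitute-∘-cong on-var
      where
      on-var : ∀ u → shiftₚ v b (shiftVariable v d u) ≈ shiftVariable v (b K.+ d) u
      on-var u with u ≟ᵥ v in eq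
      ... | yes _ rewrite eq = trans (+-assoc _ _ _) (+-cong refl (sym (con-+ b d)))
      ... | no _  rewrite eq = refl

    shiftₚ-congᵇ : ∀ v {b d} → b K.≈ d → ∀ t → shiftₚ v b t ≈ shiftₚ v d t
    shiftₚ-congᵇ v {b} {d} b≈d = substitute-cong-var on-var
      where
      on-var : ∀ u → shiftVariable v b u ≈ shiftVariable v d u
      on-var u with u ≟ᵥ v
      ... | yes _ = +-cong refl (con-cong b≈d)
      ... | no _  = refl

    ≈⇒≃ : ∀ {f g} → numerator f ≈ numerator g → denominator f ≈ denominator g → f ≃ g
    ≈⇒≃ p q = *-cong p (sym q)

    shift-comm : ∀ v w b d f → shift v b (shift w d f) ≃ shift w d (shift v b f)
    shift-comm v w b d f = ≈⇒≃ {shift v b (shift w d f)} {shift w d (shift v b f)}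
      (shiftₚ-comm v w b d (numerator f)) (shiftₚ-comm v w b d (denominator f))

    shift-+ : ∀ v b d f → shift v b (shift v d f) ≃ shift v (b K.+ d) f
    shift-+ v b d f = ≈⇒≃ {shift v b (shift v d f)} {shift v (b K.+ d) f}
      (shiftₚ-+ v b d (numerator f)) (shiftₚ-+ v b d (denominator f))

    shift-congᵇ : ∀ v {b d} → b K.≈ d → ∀ f → shift v b f ≃ shift v d f
    shift-congᵇ v {b} {d} b≈d f = ≈⇒≃ {shift v b f} {shift v d f}
      (shiftₚ-congᵇ v b≈d (numerator f)) (shiftₚ-congᵇ v b≈d (denominator f))

    ∏-cong : ∀ {k} (f g : Fin k → Rational) → (∀ i → f i ≃ g i) → ∏ f ≃ ∏ g
    ∏-cong f g = Sum.sum-cong-≋ ∙-commutativeMonoid {_} {f} {g}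

    shift-∏ : ∀ v b {k} (f : Fin k → Rational) → shift v b (∏ f) ≃ ∏ (shift v b ∘ f)
    shift-∏ v b {zero}  f = refl
    shift-∏ v b {suc k} f = M.∙-congˡ {shift v b (f zero)}
      {shift v b (∏ (f ∘ suc))} {∏ (shift v b ∘ f ∘ suc)} (shift-∏ v b (f ∘ suc))

    ∏-cyclic : ∀ k (f : ℕ → Rational) → f k ≃ f 0 →
      ∏ {k} (f ∘ suc ∘ toℕ) ≃ ∏ {k} (f ∘ toℕ)
    ∏-cyclic zero    f fk≃f0 = refl
    ∏-cyclic (suc k) f fk≃f0 = begin
      ∏ {suc k} (f ∘ suc ∘ toℕ)
        ≈⟨ Sum.sum-init-last ∙-commutativeMonoid {k} (f ∘ suc ∘ toℕ) ⟩
      ∏ {k} (f ∘ suc ∘ toℕ ∘ inject₁) ∙ f (suc (toℕ (fromℕ k)))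
        ≈⟨ M.∙-cong {∏ {k} (f ∘ suc ∘ toℕ ∘ inject₁)} {∏ {k} (f ∘ suc ∘ toℕ)}
             {f (suc (toℕ (fromℕ k)))} {f 0}
             (∏-cong {k} (f ∘ suc ∘ toℕ ∘ inject₁) (f ∘ suc ∘ toℕ) λ i →
               M.reflexive (≡.cong (f ∘ suc) (Fin.toℕ-inject₁ i)))
             (M.trans {f (suc (toℕ (fromℕ k)))} {f (suc k)} {f 0}
               (M.reflexive (≡.cong (f ∘ suc) (Fin.toℕ-fromℕ k))) fk≃f0) ⟩
      ∏ {k} (f ∘ suc ∘ toℕ) ∙ f 0
        ≈⟨ M.comm (∏ {k} (f ∘ suc ∘ toℕ)) (f 0) ⟩
      ∏ {suc k} (f ∘ toℕ)
        ∎
      where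
      open SetoidReasoning M.setoid

    module OrbitProducts
      (p : ℕ) (a : K.Carrier)
      (p·a≈0 : RawMonoidDefs._×_ K.+-rawMonoid p a K.≈ K.0#)
      where

      open RawMonoidDefs K.+-rawMonoid using () renaming (_×_ to _·_)
      open SetoidReasoning M.setoid

      orbitProduct : Variable → Rational → Rational
      orbitProduct v f = ∏ λ (i : Fin p) → shift v (toℕ i · a) f

      orbitProduct-cong : ∀ v {f g} → f ≃ g → orbitProduct v f ≃ orbitProduct v g
      orbitProduct-cong v {f} {g} f≃g =
        ∏-cong {p} (λ i → shift v (toℕ i · a) f) (λ i → shift v (toℕ i · a) g)
          λ i → shift-cong v (toℕ i · a) {f} {g} f≃g

      orbitProduct-∙ : ∀ v f g → orbitProduct v (f ∙ g) ≃ orbitProduct v f ∙ orbitProduct v g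
      orbitProduct-∙ v f g = Sum.∑-distrib-+ ∙-commutativeMonoid {p}
        (λ i → shift v (toℕ i · a) f) (λ i → shift v (toℕ i · a) g)

      shift-orbitProduct : ∀ v w f → shift w a (orbitProduct v f) ≃ orbitProduct v (shift w a f)
      shift-orbitProduct v w f = begin
        shift w a (orbitProduct v f)
          ≈⟨ shift-∏ w a (λ (i : Fin p) → shift v (toℕ i · a) f) ⟩
        ∏ (λ (i : Fin p) → shift w a (shift v (toℕ i · a) f))
          ≈⟨ ∏-cong {p} (λ i → shift w a (shift v (toℕ i · a) f))
               (λ i → shift v (toℕ i · a) (shift w a f))
               (λ i → shift-comm w v a (toℕ i · a) f) ⟩
        orbitProduct v (shift w a f)
          ∎

      Periodic : Variable → Variable → Rational → Set _
      Periodic v w f = shift w a (orbitProduct v f) ≃ orbitProduct v f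

      periodic-∙ : ∀ v w f g → Periodic v w f → Periodic v w g → Periodic v w (f ∙ g)
      periodic-∙ v w f g pf pg = begin
        shift w a (orbitProduct v (f ∙ g))
          ≈⟨ shift-cong w a {orbitProduct v (f ∙ g)} {orbitProduct v f ∙ orbitProduct v g}
               (orbitProduct-∙ v f g) ⟩
        shift w a (orbitProduct v f) ∙ shift w a (orbitProduct v g)
          ≈⟨ M.∙-cong {shift w a (orbitProduct v f)} {orbitProduct v f}
               {shift w a (orbitProduct v g)} {orbitProduct v g} pf pg ⟩
        orbitProduct v f ∙ orbitProduct v g
          ≈⟨ orbitProduct-∙ v f g ⟨
        orbitProduct v (f ∙ g)
          ∎

      periodic-fixed : ∀ v w f → shift w a f ≃ f → Periodic v w f
      periodic-fixed v w f fixed = begin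
        shift w a (orbitProduct v f)    ≈⟨ shift-orbitProduct v w f ⟩
        orbitProduct v (shift w a f)    ≈⟨ orbitProduct-cong v {shift w a f} {f} fixed ⟩
        orbitProduct v f                ∎

      periodic-∏ : ∀ v w {k} (f : Fin k → Rational) →
        (∀ i → Periodic v w (f i)) → Periodic v w (∏ f)
      periodic-∏ v w {zero}  f pf = periodic-fixed v w 1ᵣ refl
      periodic-∏ v w {suc k} f pf =
        periodic-∙ v w (f zero) (∏ (f ∘ suc)) (pf zero) (periodic-∏ v w (f ∘ suc) (pf ∘ suc))

      periodic-self : ∀ v f → Periodic v v f
      periodic-self v f = begin
        shift v a (orbitProduct v f)
          ≈⟨ shift-∏ v a (λ (i : Fin p) → shift v (toℕ i · a) f) ⟩
        ∏ (λ (i : Fin p) → shift v a (shift v (toℕ i · a) f))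
          ≈⟨ ∏-cong {p} (λ i → shift v a (shift v (toℕ i · a) f))
               (λ i → shift v (suc (toℕ i) · a) f)
               (λ i → shift-+ v a (toℕ i · a) f) ⟩
        ∏ (λ (i : Fin p) → shift v (suc (toℕ i) · a) f)
          ≈⟨ ∏-cyclic p (λ i → shift v (i · a) f) (shift-congᵇ v p·a≈0 f) ⟩
        orbitProduct v f
          ∎

      periodic-undone : ∀ v w f → shift v a (shift w a f) ≃ f → Periodic v w f
      periodic-undone v w f undone = begin
        shift w a (orbitProduct v f)
          ≈⟨ shift-orbitProduct v w f ⟩
        orbitProduct v (shift w a f)
          ≈⟨ periodic-self v (shift w a f) ⟨
        shift v a (orbitProduct v (shift w a f))
          ≈⟨ shift-orbitProduct v v (shift w a f) ⟩
        orbitProduct v (shift v a (shift w a f))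
          ≈⟨ orbitProduct-cong v {shift v a (shift w a f)} {f} undone ⟩
        orbitProduct v f
          ∎

      FixedOrUndone : Variable → Variable → Poly Variable → Set _
      FixedOrUndone v w t = shiftₚ w a t ≈ t ⊎ shiftₚ v a (shiftₚ w a t) ≈ t

      shiftₚ²-first : ∀ {v w} → v ≢ w → shiftₚ v a (shiftₚ w a (var v)) ≈ var v + con a
      shiftₚ²-first {v} {w} v≢w = P.reflexive
        (≡.trans (≡.cong (shiftₚ v a) (shiftₚ-other a v≢w)) (shiftₚ-same v a))

      shiftₚ²-second : ∀ {v w} → v ≢ w → shiftₚ v a (shiftₚ w a (var w)) ≈ var w + con a
      shiftₚ²-second {v} {w} v≢w = trans (shiftₚ-comm v w a a (var w)) (shiftₚ²-first (v≢w ∘ ≡.sym))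

      difference-undone : ∀ {v w t u} →
        shiftₚ v a (shiftₚ w a t) ≈ t + con a → shiftₚ v a (shiftₚ w a u) ≈ u + con a →
        shiftₚ v a (shiftₚ w a (t - u)) ≈ t - u
      difference-undone {t = t} {u} pt pu =
        trans (+-cong pt (-‿cong pu)) (difference-+ʳ t u (con a))

      differenceˡ : ∀ {v w′} → v ≢ w′ → ∀ w → w ≢ v → FixedOrUndone v w (var v - var w′)
      differenceˡ {v} {w′} v≢w′ w w≢v with w ≟ᵥ w′
      ... | yes ≡.refl = inj₂ $ difference-undone (shiftₚ²-first v≢w′) (shiftₚ²-second v≢w′)
      ... | no w≢w′ = inj₁ $ P.reflexive $
        ≡.cong₂ _-_ (shiftₚ-other a (w≢v ∘ ≡.sym)) (shiftₚ-other a (w≢w′ ∘ ≡.sym))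

      differenceʳ : ∀ {v w′} → v ≢ w′ → ∀ w → w ≢ v → FixedOrUndone v w (var w′ - var v)
      differenceʳ {v} {w′} v≢w′ w w≢v with w ≟ᵥ w′
      ... | yes ≡.refl = inj₂ $ difference-undone (shiftₚ²-second v≢w′) (shiftₚ²-first v≢w′)
      ... | no w≢w′ = inj₁ $ P.reflexive $
        ≡.cong₂ _-_ (shiftₚ-other a (w≢w′ ∘ ≡.sym)) (shiftₚ-other a (w≢v ∘ ≡.sym))

      _at_ : Poly ⊤ → Poly Variable → Poly Variable
      t at d = substitute (λ _ → d) t

      periodic-at : ∀ v w f {d} → (w ≢ v → FixedOrUndone v w d) →
        ∀ t u → numerator f ≡ t at d → denominator f ≡ u at d → Periodic v w f
      periodic-at v w f fixedOrUndone t u ≡.refl ≡.refl with w ≟ᵥ v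
      ... | yes ≡.refl = periodic-self v f
      ... | no w≢v with fixedOrUndone w≢v
      ...   | inj₁ fixed = periodic-fixed v w f
                (≈⇒≃ {shift w a f} {f} (fixed-at t) (fixed-at u))
        where
        fixed-at : ∀ q → shiftₚ w a (q at _) ≈ q at _
        fixed-at = substitute-∘-cong λ _ → fixed
      ...   | inj₂ undone = periodic-undone v w f
                (≈⇒≃ {shift v a (shift w a f)} {f} (undone-at t) (undone-at u))
        where
        undone-at : ∀ q → shiftₚ v a (shiftₚ w a (q at _)) ≈ q at _
        undone-at q = trans (P.reflexive (≡.cong (shiftₚ v a) (substitute-∘ _ _ q)))
          (substitute-∘-cong (λ _ → undone) q)

      module _ (κ : K.Carrier) (Λ : Fin n → K.Carrier) where

        open ScalarPCurvature K p n r a κ Λ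

        private
          y : Poly ⊤
          y = var tt

        Φ-s-factor-periodic : ∀ l w j (j≟l : Dec (j ≡ l)) →
          Periodic (inj₁ l) w (Φ-s-factor l j j≟l)
        Φ-s-factor-periodic l w j (yes _) = periodic-fixed (inj₁ l) w 1ᵣ refl
        Φ-s-factor-periodic l w j (no j≢l) =
          periodic-at (inj₁ l) w (Φ-s-factor l j (no j≢l)) (differenceˡ (λ { ≡.refl → j≢l ≡.refl }) w)
            ((y + con a) * (y - 1#)) (y * (y + 1# + con a)) ≡.refl ≡.refl

        Φ̃-periodic : ∀ l w → Periodic (inj₁ l) w (Φ l)
        Φ̃-periodic l w = periodic-∙ v w (const ∙ ∏ (Φ-x-factor l)) (∏ s-factor)
          (periodic-∙ v w const (∏ (Φ-x-factor l))
            (periodic-fixed v w const refl)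
            (periodic-∏ v w (Φ-x-factor l) λ i →
              periodic-at v w (Φ-x-factor l i) (differenceˡ (λ ()) w)
                (y + con (Λ i)) (y + con a) ≡.refl ≡.refl))
          (periodic-∏ v w s-factor λ j → Φ-s-factor-periodic l w j (j Fin.≟ l))
          where
          v = inj₁ l
          const = con κ / 1# [ 1≉0 ]
          s-factor = λ j → Φ-s-factor l j (j Fin.≟ l)

        -- Ψ does not name its factors; the nonvanishing proof chosen here is
        -- immaterial, negations being proof-irrelevant definitionally.
        Ψ-factor : Fin n → Fin r → Rational
        Ψ-factor m j = (s j - x m) / (s j - x m + con (Λ m) - con a)
          [ (λ denominator≈0 → linear≉0 _≟ᵥ_ (λ ()) (Λ m K.- a) (trans (sym constants) denominator≈0)) ]
          where
          constants : s j - x m + con (Λ m) - con a ≈ s j - x m + con (Λ m K.- a)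
          constants = trans (+-assoc _ _ _)
            (+-cong refl (trans (+-cong refl (sym (con-neg a))) (sym (con-+ _ _))))

        Ψ̃-periodic : ∀ m w → Periodic (inj₂ m) w (Ψ m)
        Ψ̃-periodic m w = periodic-∏ (inj₂ m) w (Ψ-factor m) λ j →
          periodic-at (inj₂ m) w (Ψ-factor m j) (differenceʳ (λ ()) w)
            y (y + con (Λ m) - con a) ≡.refl ≡.refl

lemma5p2 :
    ∀ {c ℓ₁ ℓ₂} (K : HeytingField c ℓ₁ ℓ₂) (p n r : ℕ) →
    let open HeytingField K
        open RationalFunctions K r n in
    HasCharacteristic K p → 2 < p → 1 ≤ n → 1 ≤ r →
    (a κ : Carrier) → a # 0# → κ # 0# → (Λ : Fin n → Carrier) →
    let open ScalarPCurvature K p n r a κ Λ in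
    (∀ (l : Fin r) (v : Variable) → shift v a (Φ̃ l) ≃ Φ̃ l)
    × (∀ (m : Fin n) (v : Variable) → shift v a (Ψ̃ m) ≃ Ψ̃ m)
lemma5p2 K p n r char _ _ _ a κ _ _ Λ = Φ̃-periodic κ Λ , Ψ̃-periodic κ Λ
  where
  p·a≈0 = ·1≈0⇒·≈0 (CommutativeRing.semiring (fieldRing K)) p (Equivalence.from (char p) ∣-refl) a

  open Shifts.OrbitProducts K r n p a p·a≈0
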